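{- Let $G$ be a simple subcubic graph, and suppose at most three edges of $G$ are properly precolored with colors from $\{1,2,3,4\}$. Then the precoloring can be extended to a proper $4$-edge-coloring of $G$.
   Context: A graph is subcubic if its maximum degree is at most $3$. A precoloring is a proper edge-coloring (adjacent edges receive distinct colors) of a subset of the edges; extending it means finding a proper edge-coloring of all of $G$ with the given colors that agrees with it on the precolored edges. -}

module Defs where

open import Data.Nat using (ℕ; _≤_)
open import Data.Fin using (Fin)
open import Data.Fin.Properties using (_≟_)
open import Data.Product using (_×_; _,_; proj₁; proj₂)
open import Data.Sum using (_⊎_)
open import Data.Maybe using (Maybe; just; nothing; is-just)
open import Data.Bool using (Bool; true; false; _∨_; T)
open import Data.List using (List; length; filter; map)
open import Data.List using () renaming (allFin to allFinL)
open import Data.Bool.Properties using (T?)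
open import Data.Product using (Σ)
open import Relation.Nullary using (¬_; does)
open import Relation.Nullary.Decidable using (⌊_⌋)
open import Relation.Binary.PropositionalEquality using (_≡_; _≢_)
open import Relation.Unary using (Decidable)

record Graph : Set where
  field
    n : ℕ
    m : ℕ
    ends : Fin m → Fin n × Fin n

open Graph public

_∈ₑ_ : {G : Graph} → Fin (n G) → Fin (m G) → Set
_∈ₑ_ {G} v e = v ≡ proj₁ (ends G e) ⊎ v ≡ proj₂ (ends G e)

sameEnds : (G : Graph) → Fin (m G) → Fin (m G) → Set
sameEnds G e f = ((proj₁ (ends G e) ≡ proj₁ (ends G f)) × (proj₂ (ends G e) ≡ proj₂ (ends G f)))
               ⊎ ((proj₁ (ends G e) ≡ proj₂ (ends G f)) × (proj₂ (ends G e) ≡ proj₁ (ends G f)))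

Simple : Graph → Set
Simple G = (∀ e → proj₁ (ends G e) ≢ proj₂ (ends G e))
         × (∀ e f → sameEnds G e f → e ≡ f)

incident : (G : Graph) → Fin (n G) → Fin (m G) → Bool
incident G v e = ⌊ v ≟ proj₁ (ends G e) ⌋ ∨ ⌊ v ≟ proj₂ (ends G e) ⌋

-- degree of v = number of edges incident to v (loops counted once; irrelevant for simple graphs)
degree : (G : Graph) → Fin (n G) → ℕ
degree G v = length (filter (λ e → T? (incident G v e)) (allFinL (m G)))

Subcubic : Graph → Set
Subcubic G = ∀ v → degree G v ≤ 3

Adjacent : (G : Graph) → Fin (m G) → Fin (m G) → Set
Adjacent G e f = e ≢ f × Σ (Fin (n G)) (λ v → (_∈ₑ_ {G} v e) × (_∈ₑ_ {G} v f))

ProperColoring : (G : Graph) (k : ℕ) → (Fin (m G) → Fin k) → Set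
ProperColoring G k c = ∀ e f → Adjacent G e f → c e ≢ c f

Precoloring : (G : Graph) (k : ℕ) → Set
Precoloring G k = Fin (m G) → Maybe (Fin k)

ProperPrecoloring : (G : Graph) (k : ℕ) → Precoloring G k → Set
ProperPrecoloring G k p = ∀ e f a b → Adjacent G e f → p e ≡ just a → p f ≡ just b → a ≢ b

numPrecolored : (G : Graph) (k : ℕ) → Precoloring G k → ℕ
numPrecolored G k p = length (filter (λ e → T? (is-just (p e))) (allFinL (m G)))

Extends : (G : Graph) (k : ℕ) → (Fin (m G) → Fin k) → Precoloring G k → Set
Extends G k c p = ∀ e a → p e ≡ just a → c e ≡ a

{-# OPTIONS --safe #-}
-- Colour the edges one at a time.  Suppose the colouring is stuck with one uncoloured edge e = uv,
-- the hole.  Then u and v see complementary pairs of colours, so the hole can be shifted to any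
-- adjacent edge f without prescribed colour: e receives the colour of f.  Shifting preserves the
-- partition {A, B} of the colours into these two pairs, and the two ends of the hole always see
-- opposite pairs.  A vertex that the hole has passed sees both classes, which forbids the hole from
-- closing a cycle.  Hence its walk ends at a leaf: a vertex whose other two edges are prescribed, with
-- colours from one class.  Starting again from a leaf x with hole xw, each of the two other edges
-- at w is either prescribed, with a colour of the opposite class, or leads to a further leaf;
-- three prescribed edges do not suffice for this.
module Submission where

open import Defs
open import Data.Nat using (ℕ; zero; suc; _≤_; z≤n; s≤s)
open import Data.Nat.Properties using (≤-trans; suc-injective)
open import Data.Fin using (Fin; zero; suc)
open import Data.Fin.Properties using (_≟_; any?; all?)
open import Data.Bool using (Bool; true; false; T)
open import Data.Bool.Properties using (T?)
open import Data.Maybe using (Maybe; just; nothing; is-just)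
open import Data.Maybe.Properties using (just-injective; ≡-dec)
open import Data.List using (List; []; _∷_; [_]; _++_; length; filter) renaming (allFin to allFinL)
open import Data.List.Membership.Propositional using (_∈_; _∉_)
open import Data.List.Membership.Propositional.Properties using (∈-filter⁺; ∈-allFin; ∈-∃++)
open import Data.List.Relation.Unary.Any using (here; there)
open import Data.List.Relation.Unary.All as All using (All; []; _∷_)
open import Data.List.Relation.Unary.AllPairs using ([]; _∷_)
open import Data.List.Relation.Unary.Unique.Propositional using (Unique)
open import Data.List.Relation.Binary.Permutation.Propositional using (_↭_)
open import Data.List.Relation.Binary.Permutation.Propositional.Properties using (∈-resp-↭; ↭-length; shift)
open import Data.Vec as Vec using (Vec)
open import Data.Vec.Properties using (lookup∘tabulate)
open import Data.Product using (Σ; ∃; ∃₂; _×_; _,_; proj₁; proj₂)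
open import Data.Sum using (_⊎_; inj₁; inj₂; [_,_]′)
open import Data.Empty using (⊥; ⊥-elim)
open import Data.Unit using (tt)
open import Function using (_∘_; case_of_)
open import Relation.Nullary using (¬_; Dec; yes; no; does; contradiction)
open import Relation.Nullary.Decidable using (_⊎-dec_; _×-dec_; _→-dec_; ¬?; map′; decidable-stable; dec-true; dec-false)
open import Relation.Binary.PropositionalEquality using (_≡_; _≢_; refl; sym; trans; cong; subst)

-- Four colours and two classes.

-- If at most one colour satisfies `P`, the other three satisfy `Q`. It is applied to the colours
-- seen at the two ends of the hole, where three colours at one end are impossible.
two-or-three : {P Q : Fin 4 → Set} → (∀ a → P a ⊎ Q a) →
  (∃₂ λ a b → a ≢ b × P a × P b) ⊎
  (∃ λ a → ∃₂ λ b c → a ≢ b × a ≢ c × b ≢ c × Q a × Q b × Q c)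
two-or-three {P} {Q} f = go (f c0) (f c1) (f c2) (f c3)
  where
  c0 c1 c2 c3 : Fin 4
  c0 = zero
  c1 = suc zero
  c2 = suc (suc zero)
  c3 = suc (suc (suc zero))
  go : P c0 ⊎ Q c0 → P c1 ⊎ Q c1 → P c2 ⊎ Q c2 → P c3 ⊎ Q c3 → _
  go (inj₁ x) (inj₁ y) _        _        = inj₁ (c0 , c1 , (λ ()) , x , y)
  go (inj₁ x) (inj₂ _) (inj₁ y) _        = inj₁ (c0 , c2 , (λ ()) , x , y)
  go (inj₁ x) (inj₂ _) (inj₂ _) (inj₁ y) = inj₁ (c0 , c3 , (λ ()) , x , y)
  go (inj₁ _) (inj₂ x) (inj₂ y) (inj₂ z) = inj₂ (c1 , c2 , c3 , (λ ()) , (λ ()) , (λ ()) , x , y , z)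
  go (inj₂ _) (inj₁ x) (inj₁ y) _        = inj₁ (c1 , c2 , (λ ()) , x , y)
  go (inj₂ _) (inj₁ x) (inj₂ _) (inj₁ y) = inj₁ (c1 , c3 , (λ ()) , x , y)
  go (inj₂ x) (inj₁ _) (inj₂ y) (inj₂ z) = inj₂ (c0 , c2 , c3 , (λ ()) , (λ ()) , (λ ()) , x , y , z)
  go (inj₂ _) (inj₂ _) (inj₁ x) (inj₁ y) = inj₁ (c2 , c3 , (λ ()) , x , y)
  go (inj₂ x) (inj₂ y) (inj₁ _) (inj₂ z) = inj₂ (c0 , c1 , c3 , (λ ()) , (λ ()) , (λ ()) , x , y , z)
  go (inj₂ x) (inj₂ y) (inj₂ z) _        = inj₂ (c0 , c1 , c2 , (λ ()) , (λ ()) , (λ ()) , x , y , z)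

three-others : (a : Fin 4) → ∃ λ b → ∃₂ λ c d →
  a ≢ b × a ≢ c × a ≢ d × b ≢ c × b ≢ d × c ≢ d
three-others zero =
  suc zero , suc (suc zero) , suc (suc (suc zero)) , (λ ()) , (λ ()) , (λ ()) , (λ ()) , (λ ()) , (λ ())
three-others (suc zero) =
  zero , suc (suc zero) , suc (suc (suc zero)) , (λ ()) , (λ ()) , (λ ()) , (λ ()) , (λ ()) , (λ ())
three-others (suc (suc zero)) =
  zero , suc zero , suc (suc (suc zero)) , (λ ()) , (λ ()) , (λ ()) , (λ ()) , (λ ()) , (λ ())
three-others (suc (suc (suc zero))) =
  zero , suc zero , suc (suc zero) , (λ ()) , (λ ()) , (λ ()) , (λ ()) , (λ ()) , (λ ())

≢-≢⇒≡ : ∀ {x y z : Bool} → x ≢ z → y ≢ z → x ≡ y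
≢-≢⇒≡ {false} {false}         _ _ = refl
≢-≢⇒≡ {true}  {true}          _ _ = refl
≢-≢⇒≡ {false} {true}  {false} p _ = contradiction refl p
≢-≢⇒≡ {false} {true}  {true}  _ q = contradiction refl q
≢-≢⇒≡ {true}  {false} {false} _ q = contradiction refl q
≢-≢⇒≡ {true}  {false} {true}  p _ = contradiction refl p

-- Lists without repetition, and finite search.

remove : ∀ {A : Set} {x : A} {xs} → x ∈ xs →
  ∃ λ ys → length xs ≡ suc (length ys) × (∀ {y} → y ∈ xs → y ≡ x ⊎ y ∈ ys)
remove {x = x} x∈xs with ys , zs , refl ← ∈-∃++ x∈xs =
  ys ++ zs , ↭-length perm , λ y∈ → head-or-tail (∈-resp-↭ perm y∈)
  where
  perm : ys ++ [ x ] ++ zs ↭ x ∷ ys ++ zs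
  perm = shift x ys zs
  head-or-tail : ∀ {y} → y ∈ x ∷ ys ++ zs → y ≡ x ⊎ y ∈ ys ++ zs
  head-or-tail (here eq) = inj₁ eq
  head-or-tail (there y∈) = inj₂ y∈

unique-⊆⇒length≤ : ∀ {A : Set} {xs ys : List A} → Unique xs → All (_∈ ys) xs → length xs ≤ length ys
unique-⊆⇒length≤ [] [] = z≤n
unique-⊆⇒length≤ {ys = ys} (x∉ ∷ u) (x∈ ∷ s) with zs , eq , split ← remove x∈ =
  subst (_ ≤_) (sym eq) (s≤s (unique-⊆⇒length≤ u (All.zipWith avoid (x∉ , s))))
  where
  avoid : ∀ {y} → _ ≢ y × y ∈ ys → y ∈ zs
  avoid (x≢y , y∈) = [ (λ y≡x → contradiction (sym y≡x) x≢y) , (λ y∈zs → y∈zs) ]′ (split y∈)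

-- Colour tables as vectors can be searched exhaustively; this is what finally turns a doubly
-- negated existence into a colouring.
∃Vec? : ∀ {k} n {P : Vec (Fin k) n → Set} → (∀ v → Dec (P v)) → Dec (∃ P)
∃Vec? zero P? = map′ (λ q → Vec.[] , q) (λ { (Vec.[] , q) → q }) (P? Vec.[])
∃Vec? (suc n) P? =
  map′ (λ { (a , v , q) → a Vec.∷ v , q }) (λ { (a Vec.∷ v , q) → a , v , q })
       (any? λ a → ∃Vec? n λ v → P? (a Vec.∷ v))

-- Edges and their ends in a simple graph.

module Incidence (G : Graph) (simple : Simple G) where

  V E : Set
  V = Fin (n G)
  E = Fin (m G)

  _on_ : V → E → Set
  v on e = _∈ₑ_ {G} v e

  _on?_ : ∀ v e → Dec (v on e)
  v on? e = (v ≟ proj₁ (ends G e)) ⊎-dec (v ≟ proj₂ (ends G e))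

  Joins : E → V → V → Set
  Joins e u v = (u ≡ proj₁ (ends G e) × v ≡ proj₂ (ends G e)) ⊎ (u ≡ proj₂ (ends G e) × v ≡ proj₁ (ends G e))

  joins-sym : ∀ {e u v} → Joins e u v → Joins e v u
  joins-sym (inj₁ (p , q)) = inj₂ (q , p)
  joins-sym (inj₂ (p , q)) = inj₁ (q , p)

  left-on : ∀ {e u v} → Joins e u v → u on e
  left-on (inj₁ (p , _)) = inj₁ p
  left-on (inj₂ (p , _)) = inj₂ p

  right-on : ∀ {e u v} → Joins e u v → v on e
  right-on = left-on ∘ joins-sym

  other-end : ∀ {e v} → v on e → ∃ (Joins e v)
  other-end (inj₁ p) = _ , inj₁ (p , refl)
  other-end (inj₂ p) = _ , inj₂ (p , refl)

  on-joins : ∀ {e u v t} → Joins e u v → t on e → t ≡ u ⊎ t ≡ v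
  on-joins (inj₁ (p , q)) (inj₁ r) = inj₁ (trans r (sym p))
  on-joins (inj₁ (p , q)) (inj₂ r) = inj₂ (trans r (sym q))
  on-joins (inj₂ (p , q)) (inj₁ r) = inj₂ (trans r (sym q))
  on-joins (inj₂ (p , q)) (inj₂ r) = inj₁ (trans r (sym p))

  joins-≢ : ∀ {e u v} → Joins e u v → u ≢ v
  joins-≢ {e} (inj₁ (refl , refl)) eq = proj₁ simple e eq
  joins-≢ {e} (inj₂ (refl , refl)) eq = proj₁ simple e (sym eq)

  on-on⇒joins : ∀ {e u v} → u ≢ v → u on e → v on e → Joins e u v
  on-on⇒joins u≢v (inj₁ p) (inj₁ q) = contradiction (trans p (sym q)) u≢v
  on-on⇒joins u≢v (inj₁ p) (inj₂ q) = inj₁ (p , q)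
  on-on⇒joins u≢v (inj₂ p) (inj₁ q) = inj₂ (p , q)
  on-on⇒joins u≢v (inj₂ p) (inj₂ q) = contradiction (trans p (sym q)) u≢v

  joins-unique : ∀ {e f u v} → Joins e u v → Joins f u v → e ≡ f
  joins-unique (inj₁ (p , q)) (inj₁ (r , s)) = proj₂ simple _ _ (inj₁ (trans (sym p) r , trans (sym q) s))
  joins-unique (inj₁ (p , q)) (inj₂ (r , s)) = proj₂ simple _ _ (inj₂ (trans (sym p) r , trans (sym q) s))
  joins-unique (inj₂ (p , q)) (inj₁ (r , s)) = proj₂ simple _ _ (inj₂ (trans (sym q) s , trans (sym p) r))
  joins-unique (inj₂ (p , q)) (inj₂ (r , s)) = proj₂ simple _ _ (inj₁ (trans (sym q) s , trans (sym p) r))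

  two-points : ∀ {e f u v} → u ≢ v → u on e → v on e → u on f → v on f → e ≡ f
  two-points u≢v a b c d = joins-unique (on-on⇒joins u≢v a b) (on-on⇒joins u≢v c d)

  -- Bounds a cardinality without deciding `P`; it serves both for the edges at a vertex and for the
  -- prescribed edges.
  AtMostThree : (E → Set) → Set
  AtMostThree P = ∀ {es} → Unique es → All P es → length es ≤ 3

  ¬four-distinct : ∀ {P} → AtMostThree P → ∀ {e f g h} → P e → P f → P g → P h →
    e ≢ f → e ≢ g → e ≢ h → f ≢ g → f ≢ h → g ≢ h → ⊥
  ¬four-distinct ≤3 pe pf pg ph ef eg eh fg fh gh
    with s≤s (s≤s (s≤s ())) ← ≤3
      ((ef ∷ eg ∷ eh ∷ []) ∷ (fg ∷ fh ∷ []) ∷ (gh ∷ []) ∷ [] ∷ [])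
      (pe ∷ pf ∷ pg ∷ ph ∷ [])

  -- Partial edge-colourings.

  Colouring : Set
  Colouring = Precoloring G 4

  variable
    c : Colouring
    e f g h : E
    u v w t : V
    a b d : Fin 4

  Proper : Colouring → Set
  Proper c = ∀ {v e f a} → v on e → v on f → c e ≡ just a → c f ≡ just a → e ≡ f

  _⊒_ : Colouring → Colouring → Set
  c ⊒ p = ∀ {e a} → p e ≡ just a → c e ≡ just a

  Sees : Colouring → V → Fin 4 → Set
  Sees c v a = ∃ λ f → v on f × c f ≡ just a

  sees? : ∀ c v a → Dec (Sees c v a)
  sees? c v a = any? λ f → (v on? f) ×-dec ≡-dec _≟_ (c f) (just a)

  just≢nothing : c f ≡ just a → c e ≡ nothing → f ≢ e
  just≢nothing q r refl with () ← trans (sym q) r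

  distinct-colours : c e ≡ just a → c f ≡ just b → a ≢ b → e ≢ f
  distinct-colours q r a≢b refl = a≢b (just-injective (trans (sym q) r))

  _[_≔_] : Colouring → E → Maybe (Fin 4) → Colouring
  (c [ e ≔ x ]) g with g ≟ e
  ... | yes _ = x
  ... | no _ = c g

  update-at : ∀ c e {x} → (c [ e ≔ x ]) e ≡ x
  update-at c e with e ≟ e
  ... | yes _ = refl
  ... | no e≢e = contradiction refl e≢e

  update-off : ∀ c {e x} → g ≢ e → (c [ e ≔ x ]) g ≡ c g
  update-off {g} c {e} g≢e with g ≟ e
  ... | yes g≡e = contradiction g≡e g≢e
  ... | no _ = refl

  erase-proper : Proper c → Proper (c [ e ≔ nothing ])
  erase-proper {e = e} pr {e = f} {f = g} vf vg cf cg with f ≟ e | g ≟ e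
  ... | no _ | no _ = pr vf vg cf cg

  update-proper : Proper c → (∀ {t f} → t on e → t on f → f ≢ e → c f ≢ just a) → Proper (c [ e ≔ just a ])
  update-proper {e = e} pr free {e = f} {f = g} vf vg cf cg with f ≟ e | g ≟ e
  ... | yes refl | yes refl = refl
  ... | yes refl | no g≢e = contradiction (trans cg (sym cf)) (free vf vg g≢e)
  ... | no f≢e | yes refl = contradiction (trans cf (sym cg)) (free vg vf f≢e)
  ... | no _ | no _ = pr vf vg cf cg

  update-⊒ : ∀ c p e x → c ⊒ p → p e ≡ nothing → (c [ e ≔ x ]) ⊒ p
  update-⊒ c p e x c⊒p pe {f} pf with f ≟ e
  ... | yes refl with () ← trans (sym pf) pe
  ... | no _ = c⊒p pf

  -- `S` collects the edges required to be coloured; it grows by one edge at a time in the final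
  -- induction.
  Completion : Colouring → (E → Set) → Set
  Completion p S = ∃ λ c → Proper c × c ⊒ p × (∀ {e} → S e → c e ≢ nothing)

  -- Shifting the hole of a stuck colouring.

  module Shifting (p : Colouring) (S : E → Set) (subcubic : ∀ v → AtMostThree (v on_))
                  (stuck : ¬ Completion p S) where

    -- Edges outside `S` may be uncoloured too; `coloured` shows that, apart from the hole itself,
    -- none of these meets an end of the hole.
    record Hole (c : Colouring) (e : E) : Set where
      field
        proper  : Proper c
        extends : c ⊒ p
        empty   : c e ≡ nothing
        full    : ∀ {g} → S g → g ≡ e ⊎ c g ≢ nothing

      free : p e ≡ nothing
      free with p e in eq
      ... | nothing = refl
      ... | just a with () ← trans (sym (extends eq)) empty

    open Hole

    -- A colour missing at both ends could be given to `e`, which would complete the colouring,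
    -- contrary to `stuck`.
    tight : Hole c e → Joins e u v → ∀ a → Sees c u a ⊎ Sees c v a
    tight {c} {e} {u} {v} H j a with sees? c u a | sees? c v a
    ... | yes s | _ = inj₁ s
    ... | no _ | yes s = inj₂ s
    ... | no ¬u | no ¬v = contradiction completion stuck
      where
      unseen : t on e → t on f → f ≢ e → c f ≢ just a
      unseen te tf _ cf with on-joins j te
      ... | inj₁ refl = ¬u (_ , tf , cf)
      ... | inj₂ refl = ¬v (_ , tf , cf)
      filled : S g → (c [ e ≔ just a ]) g ≢ nothing
      filled {g} Sg eq with g ≟ e
      ... | no g≢e = [ g≢e , (λ cg → cg eq) ]′ (full H Sg)
      completion : Completion p S
      completion = c [ e ≔ just a ] , update-proper (proper H) unseen , update-⊒ c p e (just a) (extends H) (free H) , filled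

    ¬sees-three : Hole c e → v on e → a ≢ b → a ≢ d → b ≢ d → Sees c v a → Sees c v b → Sees c v d → ⊥
    ¬sees-three {c} {v = v} H ve ab ad bd (_ , vf , cf) (_ , vg , cg) (_ , vh , ch) =
      ¬four-distinct (subcubic v) vf vg vh ve
        (distinct-colours {c} cf cg ab) (distinct-colours {c} cf ch ad) (just≢nothing {c} cf (empty H))
        (distinct-colours {c} cg ch bd) (just≢nothing {c} cg (empty H)) (just≢nothing {c} ch (empty H))

    -- If `u` saw at most one colour, `v` would see the three others by `tight`, and with the hole
    -- four edges would meet at `v`.
    sees-two : Hole c e → Joins e u v → ∃₂ λ a b → a ≢ b × Sees c u a × Sees c u b
    sees-two H j with two-or-three (tight H j)
    ... | inj₁ two = two
    ... | inj₂ (_ , _ , _ , ab , ad , bd , sa , sb , sd) =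
      ⊥-elim (¬sees-three H (right-on j) ab ad bd sa sb sd)

    -- By `tight`, one end sees two of the three colours other than `a`. If it saw `a` as well,
    -- these three edges and the hole would exceed the degree bound.
    ¬sees-both : Hole c e → Joins e u v → Sees c u a → Sees c v a → ⊥
    ¬sees-both {a = a} H j su sv
      with b₁ , b₂ , b₃ , n₁ , n₂ , n₃ , n₁₂ , n₁₃ , n₂₃ ← three-others a
      with tight H j b₁ | tight H j b₂ | tight H j b₃
    ... | inj₁ x | inj₁ y | _ = ¬sees-three H (left-on j) n₁ n₂ n₁₂ su x y
    ... | inj₁ x | inj₂ _ | inj₁ z = ¬sees-three H (left-on j) n₁ n₃ n₁₃ su x z
    ... | inj₁ _ | inj₂ y | inj₂ z = ¬sees-three H (right-on j) n₂ n₃ n₂₃ sv y z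
    ... | inj₂ _ | inj₁ y | inj₁ z = ¬sees-three H (left-on j) n₂ n₃ n₂₃ su y z
    ... | inj₂ x | inj₁ _ | inj₂ z = ¬sees-three H (right-on j) n₁ n₃ n₁₃ sv x z
    ... | inj₂ x | inj₂ y | _ = ¬sees-three H (right-on j) n₁ n₂ n₁₂ sv x y

    -- The two colours seen at `v` and the hole account for three edges there, so an uncoloured `f`
    -- would be a fourth.
    coloured : Hole c e → Joins e u v → v on f → f ≢ e → ∃ λ a → c f ≡ just a
    coloured {c} {e} {v = v} {f = f} H j vf f≢e with c f in cf
    ... | just a = a , refl
    ... | nothing
      with _ , _ , ab , (_ , vg , cg) , (_ , vh , ch) ← sees-two H (joins-sym j) =
      ⊥-elim (¬four-distinct (subcubic v) vg vh vf (right-on j)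
        (distinct-colours {c} cg ch ab) (just≢nothing {c} cg cf) (just≢nothing {c} cg (empty H))
        (just≢nothing {c} ch cf) (just≢nothing {c} ch (empty H)) f≢e)

    shifted : Colouring → E → E → Fin 4 → Colouring
    shifted c e f a = (c [ f ≔ nothing ]) [ e ≔ just a ]

    shifted-off : ∀ c → g ≢ e → g ≢ f → shifted c e f a g ≡ c g
    shifted-off c g≢e g≢f = trans (update-off _ g≢e) (update-off c g≢f)

    module Step (H : Hole c e) (j : Joins e u v) (f≢e : f ≢ e) (k : Joins f v w)
                (cf : c f ≡ just a) (pf : p f ≡ nothing) where

      c′ : Colouring
      c′ = shifted c e f a

      shift-hole : Hole c′ f
      shift-hole .proper = update-proper (erase-proper (proper H)) unseen
        where
        unseen : t on e → t on g → g ≢ e → (c [ f ≔ nothing ]) g ≢ just a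
        unseen {t} {g} te tg g≢e cg with g ≟ f
        -- The colour `a` is absent at `u` because `v` sees it through `f`; at `v` only `f` carried
        -- it, and `f` has been emptied.
        ... | no g≢f with on-joins j te
        ...   | inj₁ refl = ¬sees-both H j (g , tg , cg) (f , left-on k , cf)
        ...   | inj₂ refl = g≢f (proper H tg (left-on k) cg cf)
      shift-hole .extends =
        update-⊒ (c [ f ≔ nothing ]) p e (just a) (update-⊒ c p f nothing (extends H) pf) (free H)
      shift-hole .empty = trans (update-off _ f≢e) (update-at c f)
      shift-hole .full {g} Sg with g ≟ f
      ... | yes g≡f = inj₁ g≡f
      ... | no g≢f with g ≟ e
      ...   | yes _ = inj₂ λ ()
      ...   | no g≢e with full H Sg
      ...     | inj₁ g≡e = contradiction g≡e g≢e
      ...     | inj₂ cg = inj₂ λ eq → cg (trans (sym (update-off c g≢f)) eq)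

      -- At `v` the edge `e` takes over the colour of `f`, so the set of colours seen there does not
      -- change.
      sees-after : Sees c v b → Sees c′ v b
      sees-after (g , vg , cg) with g ≟ f
      ... | yes refl = e , right-on j , trans (update-at _ e) (trans (sym cf) cg)
      ... | no g≢f = g , vg , trans (shifted-off c (just≢nothing {c} cg (empty H)) g≢f) cg

      sees-before : Sees c′ v b → Sees c v b
      sees-before (g , vg , c′g) with g ≟ e
      ... | yes _ = f , left-on k , trans cf c′g
      ... | no g≢e with g ≟ f
      ...   | no _ = g , vg , c′g

    -- The two colour classes and the tree explored by the hole.

    module Bipartition (A : Fin 4 → Bool) where

      -- For the ends of a hole, which see complementary pairs of colours, this says that these
      -- pairs are the two classes of `A`.
      Opposite : Colouring → V → V → Set
      Opposite c u v = ∀ {a b} → Sees c u a → Sees c v b → A a ≢ A b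

      opposite-sym : Opposite c u v → Opposite c v u
      opposite-sym opp sv su eq = opp su sv (sym eq)

      -- `v` sees some colour, and with only two classes everything seen at `u` lies in the class
      -- opposite to it.
      monochromatic : Hole c e → Joins e u v → Opposite c u v → Sees c u a → Sees c u b → A a ≡ A b
      monochromatic H j opp sa sb with _ , _ , _ , sd , _ ← sees-two H (joins-sym j) =
        ≢-≢⇒≡ (opp sa sd) (opp sb sd)

      -- A colour missing at `u` is seen at `v`, hence belongs to the other class.
      class-seen : Hole c e → Joins e u v → Opposite c u v → Sees c u a → A a ≡ A b → Sees c u b
      class-seen {b = b} H j opp sa eq with tight H j b
      ... | inj₁ s = s
      ... | inj₂ s = contradiction eq (opp sa s)

      -- `v` keeps its pair of colours. A colour seen at `w` after the shift is not seen at `v`, so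
      -- `u` saw it before the shift.
      opposite-shift : (H : Hole c e) (j : Joins e u v) (f≢e : f ≢ e) (k : Joins f v w)
        (cf : c f ≡ just a) (pf : p f ≡ nothing) → Opposite c u v → Opposite (shifted c e f a) v w
      opposite-shift {c = c} {u = u} {v = v} H j f≢e k cf pf opp {a} {b} sv sw eq
        with tight H j b
      ... | inj₁ su = opp su (Step.sees-before H j f≢e k cf pf sv) (sym eq)
      ... | inj₂ sv′ = ¬sees-both (Step.shift-hole H j f≢e k cf pf) k
              (Step.sees-after H j f≢e k cf pf sv′) sw

      -- The edge `exit` is the one through which the hole last left w; the other two edges at w
      -- carry the two colours of the opposite class.
      record Mixed (c : Colouring) (F : List E) (w : V) : Set where
        field
          {exit other₁ other₂} : E
          {a₀ a₁ a₂}           : Fin 4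
          exit∈F    : exit ∈ F
          exit-on   : w on exit
          on₁       : w on other₁
          on₂       : w on other₂
          exit-col  : c exit ≡ just a₀
          col₁      : c other₁ ≡ just a₁
          col₂      : c other₂ ≡ just a₂
          opposite₁ : A a₀ ≢ A a₁
          opposite₂ : A a₀ ≢ A a₂
          others-≢  : other₁ ≢ other₂

      -- X and F are the vertices and edges of a tree that the hole has explored.
      record Explored (c : Colouring) (e : E) (u v : V) (X : List V) (F : List E) : Set where
        field
          hole   : Hole c e
          joins  : Joins e u v
          opp    : Opposite c u v
          u∈X    : u ∈ X
          v∈X    : v ∈ X
          e∈F    : e ∈ F
          F-ends : ∀ {g t} → g ∈ F → t on g → t ∈ X
          mixed  : ∀ {t} → t ∈ X → ¬ (t on e) → Mixed c F t

      open Explored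

      flip : ∀ {X F} → Explored c e u v X F → Explored c e v u X F
      flip I = record
        { hole = hole I ; joins = joins-sym (joins I) ; opp = opposite-sym (opp I)
        ; u∈X = v∈X I ; v∈X = u∈X I ; e∈F = e∈F I ; F-ends = F-ends I ; mixed = mixed I }

      explore-edge : Hole c e → Joins e u v → Opposite c u v → Explored c e u v (v ∷ u ∷ []) (e ∷ [])
      explore-edge {c} {e} {u} {v} H j o = record
        { hole = H ; joins = j ; opp = o
        ; u∈X = there (here refl) ; v∈X = here refl ; e∈F = here refl
        ; F-ends = ends-seen ; mixed = none-mixed }
        where
        ends-seen : g ∈ e ∷ [] → t on g → t ∈ v ∷ u ∷ []
        ends-seen (here refl) tg with on-joins j tg
        ... | inj₁ refl = there (here refl)
        ... | inj₂ refl = here refl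
        none-mixed : t ∈ v ∷ u ∷ [] → ¬ (t on e) → Mixed c (e ∷ []) t
        none-mixed (here refl) t∉e = contradiction (right-on j) t∉e
        none-mixed (there (here refl)) t∉e = contradiction (left-on j) t∉e

      -- Only `u` leaves the hole: its exit `e` now has a colour from the class of `v`, its two
      -- other edges keep their own class. Vertices off `e` and `f` see no change. Since `w` may
      -- already lie in `X`, the hole can also be moved back.
      move : ∀ {X F} → Explored c e u v X F → f ≢ e → Joins f v w → c f ≡ just a → p f ≡ nothing →
        Explored (shifted c e f a) f v w (w ∷ X) (f ∷ F)
      move {c} {e} {u} {v} {f} {w} {a} {X} {F} I f≢e k cf pf = record
        { hole = Step.shift-hole (hole I) (joins I) f≢e k cf pf
        ; joins = k
        ; opp = opposite-shift (hole I) (joins I) f≢e k cf pf (opp I)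
        ; u∈X = there (v∈X I)
        ; v∈X = here refl
        ; e∈F = here refl
        ; F-ends = ends′
        ; mixed = mixed′
        }
        where
        ends′ : g ∈ f ∷ F → t on g → t ∈ w ∷ X
        ends′ (here refl) tf with on-joins k tf
        ... | inj₁ refl = there (v∈X I)
        ... | inj₂ refl = here refl
        ends′ (there g∈F) tg = there (F-ends I g∈F tg)
        u∉f : ¬ (u on f)
        u∉f uf = f≢e (two-points (joins-≢ (joins I)) uf (left-on k) (left-on (joins I)) (right-on (joins I)))
        off-f : ¬ (t on f) → t on g → g ≢ f
        off-f t∉f tg refl = t∉f tg
        mixed-u : Mixed (shifted c e f a) (f ∷ F) u
        mixed-u with b₁ , b₂ , b₁≢b₂ , (g₁ , on₁ , c₁) , (g₂ , on₂ , c₂) ← sees-two (hole I) (joins I) = record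
          { exit∈F = there (e∈F I)
          ; exit-on = left-on (joins I)
          ; on₁ = on₁
          ; on₂ = on₂
          ; exit-col = update-at _ e
          ; col₁ = trans (shifted-off c (just≢nothing {c} c₁ (Hole.empty (hole I))) (off-f u∉f on₁)) c₁
          ; col₂ = trans (shifted-off c (just≢nothing {c} c₂ (Hole.empty (hole I))) (off-f u∉f on₂)) c₂
          ; opposite₁ = opposite-sym (opp I) (f , left-on k , cf) (g₁ , on₁ , c₁)
          ; opposite₂ = opposite-sym (opp I) (f , left-on k , cf) (g₂ , on₂ , c₂)
          ; others-≢ = distinct-colours {c} c₁ c₂ b₁≢b₂
          }
        mixed-far : t ∈ X → ¬ (t on e) → ¬ (t on f) → Mixed (shifted c e f a) (f ∷ F) t
        mixed-far {t} t∈X t∉e t∉f = record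
          { exit∈F = there exit∈F
          ; exit-on = exit-on ; on₁ = on₁ ; on₂ = on₂
          ; exit-col = trans (unchanged exit-on) exit-col
          ; col₁ = trans (unchanged on₁) col₁
          ; col₂ = trans (unchanged on₂) col₂
          ; opposite₁ = opposite₁ ; opposite₂ = opposite₂ ; others-≢ = others-≢
          }
          where
          open Mixed (mixed I t∈X t∉e)
          unchanged : t on g → shifted c e f a g ≡ c g
          unchanged tg = shifted-off c (λ { refl → t∉e tg }) (off-f t∉f tg)
        mixed′ : t ∈ w ∷ X → ¬ (t on f) → Mixed (shifted c e f a) (f ∷ F) t
        mixed′ (here refl) t∉f = contradiction (right-on k) t∉f
        mixed′ {t} (there t∈X) t∉f with t on? e
        ... | no t∉e = mixed-far t∈X t∉e t∉f
        ... | yes te with on-joins (joins I) te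
        ...   | inj₁ refl = mixed-u
        ...   | inj₂ refl = contradiction (left-on k) t∉f

      -- As `w` is not on `e`, the shift changes no edge at `w` except `f`; `w` is then an end of
      -- the hole and sees a single class.
      arrival-monochromatic : Hole c e → Joins e u v → Opposite c u v → f ≢ e → Joins f v w →
        c f ≡ just a → p f ≡ nothing → ¬ (w on e) →
        w on g → g ≢ f → c g ≡ just b → w on h → h ≢ f → c h ≡ just d → A b ≡ A d
      arrival-monochromatic {c} {e} {f = f} {w = w} {a = a} H j opp f≢e k cf pf w∉e wg g≢f cg wh h≢f ch =
        monochromatic (Step.shift-hole H j f≢e k cf pf) (joins-sym k)
          (opposite-sym (opposite-shift H j f≢e k cf pf opp)) (after wg g≢f cg) (after wh h≢f ch)
        where
        after : w on g → g ≢ f → c g ≡ just b → Sees (shifted c e f a) w b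
        after wg g≢f cg = _ , wg , trans (shifted-off c (λ { refl → w∉e wg }) g≢f) cg

      -- Otherwise moving the hole along f would leave w seeing both classes.
      ¬closes : ∀ {X F} → Explored c e u v X F → f ≢ e → Joins f v w → c f ≡ just a → p f ≡ nothing →
        f ∉ F → w ∉ X
      ¬closes {e = e} {f = f} {w = w} I f≢e k cf pf f∉F w∈X = mixed-arrival (mixed I w∈X w∉e)
        where
        w∉e : ¬ (w on e)
        w∉e we with on-joins (joins I) we
        ... | inj₁ refl = f≢e (joins-unique k (joins-sym (joins I)))
        ... | inj₂ refl = joins-≢ k refl
        mixed-arrival : Mixed _ _ w → ⊥
        -- `f` may be one of the two other edges at `w`, but not both, and it is not `exit`, which
        -- lies in `F`. So `exit` and one other edge remain to show both classes.
        mixed-arrival M with Mixed.other₁ M ≟ f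
        ... | no o≢f = opposite₁ (arrival-monochromatic (hole I) (joins I) (opp I) f≢e k cf pf w∉e
                exit-on (λ { refl → f∉F exit∈F }) exit-col on₁ o≢f col₁)
          where open Mixed M
        ... | yes o≡f = opposite₂ (arrival-monochromatic (hole I) (joins I) (opp I) f≢e k cf pf w∉e
                exit-on (λ { refl → f∉F exit∈F }) exit-col on₂ (λ o′≡f → others-≢ (trans o≡f (sym o′≡f))) col₂)
          where open Mixed M

      -- Leaves and the search for them.

      -- Each leaf carries its own colouring. Different leaves share only `p` and `A`, so they can
      -- be compared only through prescribed edges and classes.
      record Leaf (y : V) : Set where
        field
          {col}   : Colouring
          {gap}   : E
          {back}  : V
          tip-hole  : Hole col gap
          tip-joins : Joins gap back y
          tip-opp   : Opposite col back y
          {g₁ g₂} : E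
          {a₁ a₂} : Fin 4
          on₁     : y on g₁
          on₂     : y on g₂
          g₁≢g₂   : g₁ ≢ g₂
          pre₁    : p g₁ ≡ just a₁
          pre₂    : p g₂ ≡ just a₂

        sees₁ : Sees col y a₁
        sees₁ = g₁ , on₁ , Hole.extends tip-hole pre₁

        sees₂ : Sees col y a₂
        sees₂ = g₂ , on₂ , Hole.extends tip-hole pre₂

        a₁≢a₂ : a₁ ≢ a₂
        a₁≢a₂ a₁≡a₂ = g₁≢g₂ (Hole.proper tip-hole on₁ on₂ (Hole.extends tip-hole pre₁)
          (trans (Hole.extends tip-hole pre₂) (cong just (sym a₁≡a₂))))

        same-class : A a₁ ≡ A a₂
        same-class = monochromatic tip-hole (joins-sym tip-joins) (opposite-sym tip-opp) sees₁ sees₂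

      -- F′-new ensures that after a search through f the third edge at v is still unexplored.
      record LeafFound (e f : E) (u v : V) (X₀ X : List V) (F : List E) : Set where
        field
          {c′}     : Colouring
          {X′}     : List V
          {F′}     : List E
          {y}      : V
          explored : Explored c′ e u v X′ F′
          X⊆X′     : ∀ {t} → t ∈ X → t ∈ X′
          F⊆F′     : ∀ {g} → g ∈ F → g ∈ F′
          F′-new   : ∀ {g} → g ∈ F′ → g ∈ F ⊎ g ≡ f ⊎ (∀ {t} → t on g → t ∉ X₀)
          y∈X′     : y ∈ X′
          y∉X₀     : y ∉ X₀
          leaf     : Leaf y

      -- `k` bounds the number of unvisited vertices; the search recurses on it.
      Covers : List V → ℕ → List V → Set
      Covers rem k X = length rem ≡ k × (∀ t → t ∈ X ⊎ t ∈ rem)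

      -- After the search beyond `f` the hole is at `f` again. It can return to `e`, which is not
      -- prescribed because it was a hole, so a further search can start from the same place.
      step-back : ∀ {X F} → Explored c e u v X F → f ≢ e →
        LeafFound f f v w X (w ∷ X) (f ∷ F) → LeafFound e f u v X X F
      step-back {e = e} {u} {v} {f} {w} {X} {F} I f≢e L = record
        { explored = flip (move back e≢f (joins-sym (joins I)) (proj₂ e-col) (Hole.free (hole I)))
        ; X⊆X′ = λ q → there (X⊆X′ (there q))
        ; F⊆F′ = λ q → there (F⊆F′ (there q))
        ; F′-new = new′
        ; y∈X′ = there y∈X′ ; y∉X₀ = y∉X₀ ; leaf = leaf }
        where
        open LeafFound L
        back : Explored c′ f w v X′ F′
        back = flip explored
        e≢f : e ≢ f
        e≢f e≡f = f≢e (sym e≡f)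
        e-col : ∃ λ b → c′ e ≡ just b
        e-col = coloured (hole back) (joins back) (right-on (joins I)) e≢f
        new′ : g ∈ e ∷ F′ → g ∈ F ⊎ g ≡ f ⊎ (∀ {t} → t on g → t ∉ X)
        new′ (here refl) = inj₁ (e∈F I)
        new′ (there g∈F′) with F′-new g∈F′
        ... | inj₁ (here g≡f) = inj₂ (inj₁ g≡f)
        ... | inj₁ (there g∈F) = inj₁ g∈F
        ... | inj₂ r = inj₂ r

      -- Seen from the vertices before `v`, the edge `f` is one that avoids them: `v` is new, and so
      -- is the far end of `f` by `¬closes`.
      drop-front : ∀ {X F} → Explored c e u v (v ∷ X) F → v ∉ X → v on f → f ≢ e → p f ≡ nothing → f ∉ F →
        LeafFound e f u v (v ∷ X) (v ∷ X) F → LeafFound e e u v X (v ∷ X) F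
      drop-front {e = e} {f = f} {X} {F} I v∉X vf f≢e pf f∉F L = record
        { explored = explored ; X⊆X′ = X⊆X′ ; F⊆F′ = F⊆F′ ; F′-new = new′
        ; y∈X′ = y∈X′ ; y∉X₀ = λ y∈X → y∉X₀ (there y∈X) ; leaf = leaf }
        where
        open LeafFound L
        ends-new : t on f → t ∉ X
        ends-new tf t∈X
          with w , k ← other-end vf
          with a , cf ← coloured (hole I) (joins I) vf f≢e
          with on-joins k tf
        ... | inj₁ refl = v∉X t∈X
        ... | inj₂ refl = ¬closes I f≢e k cf pf f∉F (there t∈X)
        new′ : g ∈ F′ → g ∈ F ⊎ g ≡ e ⊎ (∀ {t} → t on g → t ∉ X)
        new′ g∈F′ with F′-new g∈F′
        ... | inj₁ g∈F = inj₁ g∈F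
        ... | inj₂ (inj₁ refl) = inj₂ (inj₂ ends-new)
        ... | inj₂ (inj₂ off) = inj₂ (inj₂ λ tg t∈X → off tg (there t∈X))

      fresh-edge : ∀ {X F} → Explored c e u v X F → w ∉ X → g ∈ f ∷ F → w on g → g ≡ f
      fresh-edge I w∉X (here g≡f) _ = g≡f
      fresh-edge I w∉X (there g∈F) wg = contradiction (F-ends I g∈F wg) w∉X

      covers-step : ∀ {k rem X} → Covers rem (suc k) X → w ∈ rem → ∃ λ rem′ → Covers rem′ k (w ∷ X)
      covers-step {w} {k} {rem} {X} (len , cover) w∈rem with rem′ , len′ , split ← remove w∈rem =
        rem′ , suc-injective (trans (sym len′) len) , cover′
        where
        cover′ : ∀ t → t ∈ w ∷ X ⊎ t ∈ rem′
        cover′ t with cover t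
        ... | inj₁ t∈X = inj₁ (there t∈X)
        ... | inj₂ t∈rem with split t∈rem
        ...   | inj₁ t≡w = inj₁ (here t≡w)
        ...   | inj₂ t∈rem′ = inj₂ t∈rem′

      covers-zero : ∀ {rem X} → Covers rem zero X → t ∈ X
      covers-zero {t} {[]} (_ , cover) with inj₁ t∈X ← cover t = t∈X

      mutual
        -- The walk goes on along any unprescribed edge at `v` and reaches a new vertex each time,
        -- so `k` decreases; it stops only when both other edges at `v` are prescribed.
        find-leaf : ∀ k {rem X F} → Covers rem k (v ∷ X) → v ∉ X → (∀ {g} → g ∈ F → v on g → g ≡ e) →
          Explored c e u v (v ∷ X) F → LeafFound e e u v X (v ∷ X) F
        find-leaf {v} {e} {c} k {X = X} {F} cover v∉X only-e I
          with a , b , a≢b , (g₁ , on₁ , c₁) , (g₂ , on₂ , c₂) ← sees-two (hole I) (joins-sym (joins I))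
          with p g₁ in pre₁ | p g₂ in pre₂
        ... | just _ | just _ = record
          { explored = I ; X⊆X′ = λ q → q ; F⊆F′ = λ q → q ; F′-new = inj₁
          ; y∈X′ = here refl ; y∉X₀ = v∉X
          ; leaf = record
            { tip-hole = hole I ; tip-joins = joins I ; tip-opp = opp I ; on₁ = on₁ ; on₂ = on₂
            ; g₁≢g₂ = distinct-colours {c} c₁ c₂ a≢b ; pre₁ = pre₁ ; pre₂ = pre₂ } }
        ... | nothing | _ = along k cover v∉X only-e I on₁ (just≢nothing {c} c₁ (Hole.empty (hole I))) pre₁
        ... | just _ | nothing = along k cover v∉X only-e I on₂ (just≢nothing {c} c₂ (Hole.empty (hole I))) pre₂

        along : ∀ k {rem X F} → Covers rem k (v ∷ X) → v ∉ X → (∀ {g} → g ∈ F → v on g → g ≡ e) →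
          Explored c e u v (v ∷ X) F → v on f → f ≢ e → p f ≡ nothing → LeafFound e e u v X (v ∷ X) F
        along k cover v∉X only-e I vf f≢e pf =
          drop-front I v∉X vf f≢e pf f∉F (branch k cover I vf f≢e pf f∉F)
          where
          f∉F : _
          f∉F f∈F = f≢e (only-e f∈F vf)

        branch : ∀ k {rem X F} → Covers rem k X → Explored c e u v X F →
          v on f → f ≢ e → p f ≡ nothing → f ∉ F → LeafFound e f u v X X F
        branch k cover I vf f≢e pf f∉F
          with w , j ← other-end vf
          with a , cf ← coloured (hole I) (joins I) vf f≢e
          = onward k cover I f≢e j cf pf (¬closes I f≢e j cf pf f∉F)

        onward : ∀ k {rem X F} → Covers rem k X → Explored c e u v X F →
          f ≢ e → Joins f v w → c f ≡ just a → p f ≡ nothing → w ∉ X → LeafFound e f u v X X F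
        onward zero cover I f≢e j cf pf w∉X = contradiction (covers-zero cover) w∉X
        onward {w = w} (suc k) cover I f≢e j cf pf w∉X with proj₂ cover w
        ... | inj₁ w∈X = contradiction w∈X w∉X
        ... | inj₂ w∈rem with rem′ , cover′ ← covers-step cover w∈rem =
          step-back I f≢e (find-leaf k cover′ w∉X (fresh-edge I w∉X)
            (move I f≢e j cf pf))

      -- Counting prescribed edges at leaves.

      -- `q` is the one prescribed edge besides `g₁` and `g₂`; the leaf `y` lies on `q` and on one
      -- of these two.
      record ThirdEdge {x} (L : Leaf x) (y : V) : Set where
        open Leaf L
        field
          {q q′}   : E
          {r}      : Fin 4
          q-pre    : p q ≡ just r
          q-on     : y on q
          q′-on    : y on q′
          q≢g₁     : q ≢ g₁
          q≢g₂     : q ≢ g₂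
          q′-old   : q′ ≡ g₁ ⊎ q′ ≡ g₂
          q′≢q     : q′ ≢ q
          q′-pre   : p q′ ≢ just r
          q-class  : A r ≡ A a₁

      module Contradiction (≤3-pre : AtMostThree (λ e → ∃ λ a → p e ≡ just a)) where

        -- The prescribed edges at `y` are not both old, as `g₁` and `g₂` already share `x`, and not
        -- both new, as four edges would be prescribed. The two agree in class, so the new one
        -- inherits the class of `a₁` from the old one.
        third-edge : ∀ {x y} (L : Leaf x) → Leaf y → y ≢ x → ThirdEdge L y
        third-edge {x} {y} L M y≢x = from (old? M.g₁) (old? M.g₂)
          where
          open Leaf L
          module M = Leaf M
          Old : E → Set
          Old g = g ≡ g₁ ⊎ g ≡ g₂
          old? : ∀ g → Dec (Old g)
          old? g = (g ≟ g₁) ⊎-dec (g ≟ g₂)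
          ¬both : ¬ (y on g₁ × y on g₂)
          ¬both (y₁ , y₂) = g₁≢g₂ (two-points y≢x y₁ on₁ y₂ on₂)
          old-class : ∀ {b} → Old g → p g ≡ just b → A b ≡ A a₁
          old-class (inj₁ refl) pg = cong A (just-injective (trans (sym pg) pre₁))
          old-class (inj₂ refl) pg = trans (cong A (just-injective (trans (sym pg) pre₂))) (sym same-class)
          from : Dec (Old M.g₁) → Dec (Old M.g₂) → ThirdEdge L y
          from (yes (inj₁ refl)) (yes (inj₁ refl)) = contradiction refl M.g₁≢g₂
          from (yes (inj₁ refl)) (yes (inj₂ refl)) = contradiction (M.on₁ , M.on₂) ¬both
          from (yes (inj₂ refl)) (yes (inj₁ refl)) = contradiction (M.on₂ , M.on₁) ¬both
          from (yes (inj₂ refl)) (yes (inj₂ refl)) = contradiction refl M.g₁≢g₂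
          from (no ¬o₁) (yes o₂) = record
            { q-pre = M.pre₁ ; q-on = M.on₁ ; q′-on = M.on₂ ; q≢g₁ = ¬o₁ ∘ inj₁ ; q≢g₂ = ¬o₁ ∘ inj₂
            ; q′-old = o₂ ; q′≢q = M.g₁≢g₂ ∘ sym
            ; q′-pre = λ eq → M.a₁≢a₂ (just-injective (trans (sym eq) M.pre₂))
            ; q-class = trans M.same-class (old-class o₂ M.pre₂) }
          from (yes o₁) (no ¬o₂) = record
            { q-pre = M.pre₂ ; q-on = M.on₂ ; q′-on = M.on₁ ; q≢g₁ = ¬o₂ ∘ inj₁ ; q≢g₂ = ¬o₂ ∘ inj₂
            ; q′-old = o₁ ; q′≢q = M.g₁≢g₂
            ; q′-pre = λ eq → M.a₁≢a₂ (just-injective (trans (sym M.pre₁) eq))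
            ; q-class = trans (sym M.same-class) (old-class o₁ M.pre₁) }
          from (no ¬o₁) (no ¬o₂) = ⊥-elim (¬four-distinct ≤3-pre
            (_ , pre₁) (_ , pre₂) (_ , M.pre₁) (_ , M.pre₂) g₁≢g₂
            (¬o₁ ∘ inj₁ ∘ sym) (¬o₂ ∘ inj₁ ∘ sym) (¬o₁ ∘ inj₂ ∘ sym) (¬o₂ ∘ inj₂ ∘ sym) M.g₁≢g₂)

        -- By `class-seen`, `x` sees the whole class of `a₁`; next to the hole there is no room for
        -- a third colour besides `a₁` and `a₂`.
        ¬three-colours : ∀ {x r} (L : Leaf x) → r ≢ Leaf.a₁ L → r ≢ Leaf.a₂ L → A r ≢ A (Leaf.a₁ L)
        ¬three-colours L r≢a₁ r≢a₂ r-class =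
          ¬sees-three tip-hole (right-on tip-joins) a₁≢a₂ (r≢a₁ ∘ sym) (r≢a₂ ∘ sym) sees₁ sees₂
            (class-seen tip-hole (joins-sym tip-joins) (opposite-sym tip-opp) sees₁ (sym r-class))
          where open Leaf L

        -- The third prescribed edge is the same for `y` and `z`, so it joins them. By simplicity
        -- their old edges differ; hence it is adjacent to both `g₁` and `g₂`, and its colour is a
        -- third one in their class.
        ¬three-leaves : ∀ {x y z} → Leaf x → Leaf y → Leaf z → y ≢ x → z ≢ x → z ≢ y → ⊥
        ¬three-leaves {x} {y} {z} L M N y≢x z≢x z≢y = clash Y.q′-old Z.q′-old
          where
          open Leaf L
          module Y = ThirdEdge (third-edge L M y≢x)
          module Z = ThirdEdge (third-edge L N z≢x)
          q≡ : Z.q ≡ Y.q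
          q≡ with Z.q ≟ Y.q
          ... | yes eq = eq
          ... | no q≢ = ⊥-elim (¬four-distinct ≤3-pre (_ , pre₁) (_ , pre₂) (_ , Z.q-pre) (_ , Y.q-pre)
                  g₁≢g₂ (Z.q≢g₁ ∘ sym) (Y.q≢g₁ ∘ sym) (Z.q≢g₂ ∘ sym) (Y.q≢g₂ ∘ sym) q≢)
          r≡ : Z.r ≡ Y.r
          r≡ = just-injective (trans (sym Z.q-pre) (trans (cong p q≡) Y.q-pre))
          q′≢ : Z.q′ ≢ Y.q′
          q′≢ eq = Y.q′≢q (two-points z≢y (subst (z on_) eq Z.q′-on) Y.q′-on (subst (z on_) q≡ Z.q-on) Y.q-on)
          y-new : ∀ {g b} → Y.q′ ≡ g → p g ≡ just b → Y.r ≢ b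
          y-new eq pg r≡b = Y.q′-pre (trans (cong p eq) (trans pg (cong just (sym r≡b))))
          z-new : ∀ {g b} → Z.q′ ≡ g → p g ≡ just b → Y.r ≢ b
          z-new eq pg r≡b = Z.q′-pre (trans (cong p eq) (trans pg (cong just (sym (trans r≡ r≡b)))))
          clash : Y.q′ ≡ g₁ ⊎ Y.q′ ≡ g₂ → Z.q′ ≡ g₁ ⊎ Z.q′ ≡ g₂ → ⊥
          clash (inj₁ i) (inj₁ j) = q′≢ (trans j (sym i))
          clash (inj₁ i) (inj₂ j) = ¬three-colours L (y-new i pre₁) (z-new j pre₂) Y.q-class
          clash (inj₂ i) (inj₁ j) = ¬three-colours L (z-new j pre₁) (y-new i pre₂) Y.q-class
          clash (inj₂ i) (inj₂ j) = q′≢ (trans j (sym i))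

        class-≢ : p e ≡ just a → p f ≡ just b → A a ≢ A b → e ≢ f
        class-≢ pe pf a≢b refl = a≢b (cong A (just-injective (trans (sym pe) pf)))

        all-vertices : ∀ {X} → Covers (allFinL (n G)) (length (allFinL (n G))) X
        all-vertices = refl , λ t → inj₂ (∈-allFin t)

        -- Cases by the other two edges `o₁`, `o₂` at `back`: if one or both are prescribed, there
        -- are four prescribed edges; if none is, there are three leaves.
        ¬leaf : ∀ {x} → ¬ Leaf x
        ¬leaf {x} L
          with a , b , a≢b , (o₁ , w₁ , c₁) , (o₂ , w₂ , c₂) ← sees-two (Leaf.tip-hole L) (Leaf.tip-joins L)
          = neighbours (p o₁) (p o₂) refl refl
          where
          open Leaf L
          start : Explored col gap x back (back ∷ x ∷ []) (gap ∷ [])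
          start = explore-edge tip-hole (joins-sym tip-joins) (opposite-sym tip-opp)
          only-gap : g ≢ gap → g ∉ gap ∷ []
          only-gap g≢ (here eq) = g≢ eq
          o₁≢gap : o₁ ≢ gap
          o₁≢gap = just≢nothing {col} c₁ (Hole.empty tip-hole)
          o₂≢gap : o₂ ≢ gap
          o₂≢gap = just≢nothing {col} c₂ (Hole.empty tip-hole)
          o₁≢o₂ : o₁ ≢ o₂
          o₁≢o₂ = distinct-colours {col} c₁ c₂ a≢b
          across : back on f → p f ≡ just d → A d ≢ A a₁
          across {f} bf pf = tip-opp (f , bf , Hole.extends tip-hole pf) sees₁
          ¬one-precoloured : back on f → p f ≡ just d →
            ¬ LeafFound gap g x back (back ∷ x ∷ []) (back ∷ x ∷ []) (gap ∷ [])
          -- The third edge has the class of `a₁` and `f` the opposite class, so `f` is a fourth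
          -- prescribed edge.
          ¬one-precoloured bf pf Y = ¬four-distinct ≤3-pre (_ , pre₁) (_ , pre₂) (_ , T.q-pre) (_ , pf)
              g₁≢g₂ (T.q≢g₁ ∘ sym) (class-≢ pre₁ pf (across bf pf ∘ sym))
              (T.q≢g₂ ∘ sym) (class-≢ pre₂ pf λ eq → across bf pf (trans (sym eq) (sym same-class)))
              (class-≢ T.q-pre pf λ eq → across bf pf (trans (sym eq) T.q-class))
            where
            module T = ThirdEdge (third-edge L (LeafFound.leaf Y) (λ y≡x → LeafFound.y∉X₀ Y (there (here y≡x))))
          ¬two-branches : (Y : LeafFound gap f x back (back ∷ x ∷ []) (back ∷ x ∷ []) (gap ∷ [])) →
            ¬ LeafFound gap g x back (LeafFound.X′ Y) (LeafFound.X′ Y) (LeafFound.F′ Y)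
          ¬two-branches Y Z = ¬three-leaves L Y.leaf Z.leaf
              (λ y≡x → Y.y∉X₀ (there (here y≡x)))
              (λ z≡x → Z.y∉X₀ (Y.X⊆X′ (there (here z≡x))))
              (λ z≡y → Z.y∉X₀ (subst (_∈ Y.X′) (sym z≡y) Y.y∈X′))
            where
            module Y = LeafFound Y
            module Z = LeafFound Z
          second-branch : p o₂ ≡ nothing → ¬ LeafFound gap o₁ x back (back ∷ x ∷ []) (back ∷ x ∷ []) (gap ∷ [])
          second-branch p₂ Y =
              -- The second search keeps the tree of the first, so its leaf is new. The edge `o₂` is
              -- not in that tree: it meets `back` and is neither `gap` nor `o₁`.
              ¬two-branches Y (branch _ all-vertices Y.explored w₂ o₂≢gap p₂ o₂∉F′)
            where
            module Y = LeafFound Y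
            o₂∉F′ : o₂ ∉ Y.F′
            o₂∉F′ o₂∈ with Y.F′-new o₂∈
            ... | inj₁ o₂∈F = only-gap o₂≢gap o₂∈F
            ... | inj₂ (inj₁ eq) = o₁≢o₂ (sym eq)
            ... | inj₂ (inj₂ off) = off w₂ (here refl)
          neighbours : ∀ m₁ m₂ → p o₁ ≡ m₁ → p o₂ ≡ m₂ → ⊥
          neighbours (just _) (just _) p₁ p₂ = ¬four-distinct ≤3-pre (_ , pre₁) (_ , pre₂) (_ , p₁) (_ , p₂)
            g₁≢g₂ (class-≢ pre₁ p₁ (across w₁ p₁ ∘ sym)) (class-≢ pre₁ p₂ (across w₂ p₂ ∘ sym))
            (class-≢ pre₂ p₁ λ eq → across w₁ p₁ (trans (sym eq) (sym same-class)))
            (class-≢ pre₂ p₂ λ eq → across w₂ p₂ (trans (sym eq) (sym same-class))) o₁≢o₂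
          neighbours (just _) nothing p₁ p₂ = 
            ¬one-precoloured w₁ p₁ (branch _ all-vertices start w₂ o₂≢gap p₂ (only-gap o₂≢gap))
          neighbours nothing (just _) p₁ p₂ = 
            ¬one-precoloured w₂ p₂ (branch _ all-vertices start w₁ o₁≢gap p₁ (only-gap o₁≢gap))
          neighbours nothing nothing p₁ p₂ =
            second-branch p₂ (branch _ all-vertices start w₁ o₁≢gap p₁ (only-gap o₁≢gap))

        ¬opposite-hole : Hole c e → Joins e u v → ¬ Opposite c u v
        ¬opposite-hole {e = e} {u} {v} H j o =
          ¬leaf (LeafFound.leaf (find-leaf _ all-vertices v∉u only-e (explore-edge H j o)))
          where
          v∉u : v ∉ u ∷ []
          v∉u (here refl) = joins-≢ j refl
          only-e : g ∈ e ∷ [] → v on g → g ≡ e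
          only-e (here eq) _ = eq

    -- Choice of the classes, and extension edge by edge.

    ¬hole-joining : AtMostThree (λ e → ∃ λ a → p e ≡ just a) → Hole c e → ¬ Joins e u v
    ¬hole-joining {c} {e} {u} {v} ≤3-pre H j =
      Bipartition.Contradiction.¬opposite-hole A ≤3-pre H j seen-unseen
      where
      -- One class consists of the colours seen at `u` in the initial colouring `c`; it stays fixed
      -- while the hole moves.
      A : Fin 4 → Bool
      A a = does (sees? c u a)
      seen-unseen : Sees c u a → Sees c v b → A a ≢ A b
      seen-unseen {a} {b} su sv eq
        with () ← trans (sym (dec-true (sees? c u a) su))
                    (trans eq (dec-false (sees? c u b) λ su′ → ¬sees-both H j su′ sv))

    ¬hole : AtMostThree (λ e → ∃ λ a → p e ≡ just a) → ¬ Hole c e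
    ¬hole {e = e} ≤3-pre H = ¬hole-joining ≤3-pre H (proj₂ (other-end {e} (inj₁ refl)))

  -- Induction on the edges required to be coloured. The double negation supplies `stuck` for each
  -- new edge without deciding whether a completion exists.
  ¬¬completion : ∀ {p} → (∀ v → AtMostThree (v on_)) → AtMostThree (λ e → ∃ λ a → p e ≡ just a) →
    Proper p → ∀ es → ¬ ¬ Completion p (_∈ es)
  ¬¬completion {p} _ _ pr [] stuck = stuck (p , pr , (λ pe → pe) , λ ())
  ¬¬completion {p} subcubic ≤3-pre pr (e ∷ es) stuck = ¬¬completion subcubic ≤3-pre pr es colour-e
    where
    colour-e : ¬ Completion p (_∈ es)
    colour-e (c , prc , ext , full) with c e in ce
    ... | just _ = stuck (c , prc , ext , λ { (here refl) ce′ → case trans (sym ce) ce′ of λ () ; (there g∈) → full g∈ })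
    ... | nothing = ¬hole ≤3-pre record
      { proper = prc ; extends = ext ; empty = ce
      ; full = λ { (here eq) → inj₁ eq ; (there g∈) → inj₂ (full g∈) } }
      where open Shifting p (_∈ (e ∷ es)) subcubic stuck

  -- From counts and partial colourings to a total colouring.

  count≤3 : ∀ {P : E → Set} (b : E → Bool) → (∀ {e} → P e → T (b e)) →
    length (filter (λ e → T? (b e)) (allFinL (m G))) ≤ 3 → AtMostThree P
  count≤3 b P⇒b ≤3 unique all =
    ≤-trans (unique-⊆⇒length≤ unique
      (All.map (λ Pe → ∈-filter⁺ (λ e → T? (b e)) (∈-allFin _) (P⇒b Pe)) all)) ≤3

  on⇒incident : v on e → T (incident G v e)
  on⇒incident {v} {e} ve with v ≟ proj₁ (ends G e) | v ≟ proj₂ (ends G e)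
  ... | yes _ | _ = tt
  ... | no _ | yes _ = tt
  ... | no ¬p | no ¬q = [ ¬p , ¬q ]′ ve

  just⇒is-just : ∀ {x : Maybe (Fin 4)} → x ≡ just a → T (is-just x)
  just⇒is-just refl = tt

  Solution : Colouring → (E → Fin 4) → Set
  Solution p c = ProperColoring G 4 c × Extends G 4 c p

  solution? : ∀ p c → Dec (Solution p c)
  solution? p c =
    (all? λ e → all? λ f →
      (¬? (e ≟ f) ×-dec any? λ v → (v on? e) ×-dec (v on? f)) →-dec ¬? (c e ≟ c f))
    ×-dec
    (all? λ e → all? λ a → ≡-dec _≟_ (p e) (just a) →-dec (c e ≟ a))

  total-solution : ∀ {p} → Completion p (_∈ allFinL (m G)) → ∃ λ (table : Vec (Fin 4) (m G)) → Solution p (Vec.lookup table)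
  total-solution {p} (c , pr , ext , full) = table , proper′ , extends′
    where
    colour : ∀ e → ∃ λ a → c e ≡ just a
    colour e with c e | full (∈-allFin e)
    ... | just a  | _ = a , refl
    ... | nothing | ce≢ = contradiction refl ce≢
    table : Vec (Fin 4) (m G)
    table = Vec.tabulate (proj₁ ∘ colour)
    agrees : ∀ e → c e ≡ just (Vec.lookup table e)
    agrees e = trans (proj₂ (colour e)) (cong just (sym (lookup∘tabulate (proj₁ ∘ colour) e)))
    proper′ : ProperColoring G 4 (Vec.lookup table)
    proper′ e f (e≢f , v , ve , vf) eq = e≢f (pr ve vf (agrees e) (trans (agrees f) (cong just (sym eq))))
    extends′ : Extends G 4 (Vec.lookup table) p
    extends′ e a pe = just-injective (trans (sym (agrees e)) (ext pe))

theorem4 : (G : Graph) → Simple G → Subcubic G →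
    (p : Precoloring G 4) → ProperPrecoloring G 4 p → numPrecolored G 4 p ≤ 3 →
    Σ (Fin (m G) → Fin 4) (λ c → ProperColoring G 4 c × Extends G 4 c p)
theorem4 G simple subcubic p proper few
  = Vec.lookup (proj₁ found) , proj₂ found
  where
  open Incidence G simple
  proper′ : Proper p
  proper′ {e = e} {f} ve vf pe pf with e ≟ f
  ... | yes e≡f = e≡f
  ... | no e≢f = contradiction refl (proper e f _ _ (e≢f , _ , ve , vf) pe pf)
  ¬¬solution : ¬ ¬ (∃ λ table → Solution p (Vec.lookup table))
  ¬¬solution none = ¬¬completion
    (λ v → count≤3 (incident G v) on⇒incident (subcubic v))
    (count≤3 (λ e → is-just (p e)) (just⇒is-just ∘ proj₂) few)
    proper′ (allFinL (m G)) (none ∘ total-solution)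
  found : ∃ λ table → Solution p (Vec.lookup table)
  -- There are finitely many tables and `Solution` is decidable, so the double negation can be
  -- removed.
  found = decidable-stable (∃Vec? (m G) λ table → solution? p (Vec.lookup table)) ¬¬solution
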